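{- Let $n\ge 1$ and let $p_1(x),\dots,p_n(x)\in\mathbb{Q}[x]$ be non-constant polynomials that are pairwise relatively prime, i.e. $\gcd(p_i(x),p_j(x))=1$ whenever $i\ne j$. Then the following identity holds in $\mathbb{Q}(x)$: $$\frac{1}{p_1(x)\cdots p_n(x)}=\frac{k_1(x)}{p_1(x)}+\cdots+\frac{k_n(x)}{p_n(x)},\qquad k_i(x)=\mathrm{eval}\Big(\prod_{j=1,\,j\ne i}^{n}\frac{1}{p_j(x)};\ p_i(x)\Big)\quad(1\le i\le n).$$
   Context: For $f,p\in\mathbb{Q}[x]$ with $p\neq 0$, $f\ \mathrm{rem}\ p$ denotes the unique $r\in\mathbb{Q}[x]$ with $\deg r<\deg p$ and $f=pq+r$ for some $q\in\mathbb{Q}[x]$. For $r,s,a\in\mathbb{Q}[x]$ with $\gcd(s,a)=1$, the evaluation of the fraction $r/s$ modulo $a$ is the polynomial $\mathrm{eval}\big(\tfrac{r(x)}{s(x)};\,a(x)\big)=(\alpha(x)r(x))\ \mathrm{rem}\ a(x)$, where $\alpha\in\mathbb{Q}[x]$ is any polynomial with $\alpha(x)s(x)\equiv 1 \pmod{a(x)}$. -}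

module Defs where

open import Algebra.Bundles.Raw using (RawRing; RawSemiring)
import Algebra.Definitions.RawSemiring as RawSemiringDefs
open import Data.Fin.Base using (Fin; zero; suc)
open import Data.List.Base using (List; []; _∷_; map)
open import Data.Nat.Base as ℕ using (ℕ; zero; suc)
open import Data.Product.Base using (_×_; _,_; ∃)
open import Data.Rational.Base as ℚ using (ℚ; 0ℚ; 1ℚ; 1/_)
import Data.Rational.Properties as ℚ
open import Data.Vec.Functional using (Vector)
open import Level using (0ℓ)
open import Relation.Binary.Construct.Add.Infimum.Strict ℕ._<_ using (_<₋_; ⊥₋<[_]; [_])
open import Relation.Binary.PropositionalEquality
  using (_≡_; refl; sym; trans; cong; cong₂; subst; module ≡-Reasoning)
open import Relation.Nullary using (¬_; yes; no; contradiction)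
open import Relation.Nullary.Construct.Add.Infimum using (_₋; ⊥₋; [_])

infix  4 _≈_ _≡_[mod_]
infixl 6 _+_
infixl 7 _*_
infixr 7 _·_
infix  8 -_

-- Coefficient lists, constant term first. Trailing zeros are allowed, so
-- equality of polynomials is the coefficientwise relation _≈_, not _≡_.

ℚ[x] : Set
ℚ[x] = List ℚ

coeff : ℚ[x] → ℕ → ℚ
coeff []      _       = 0ℚ
coeff (a ∷ f) zero    = a
coeff (a ∷ f) (suc n) = coeff f n

record _≈_ (f g : ℚ[x]) : Set where
  constructor mk≈
  field coeff-≡ : ∀ n → coeff f n ≡ coeff g n

open _≈_ public

_+_ : ℚ[x] → ℚ[x] → ℚ[x]
[]      + g       = g
(a ∷ f) + []      = a ∷ f
(a ∷ f) + (b ∷ g) = (a ℚ.+ b) ∷ (f + g)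

_·_ : ℚ → ℚ[x] → ℚ[x]
a · f = map (a ℚ.*_) f

-_ : ℚ[x] → ℚ[x]
- f = map (λ a → ℚ.- a) f

-- (a + x f) g = a g + x (f g)
_*_ : ℚ[x] → ℚ[x] → ℚ[x]
[]      * g = []
(a ∷ f) * g = a · g + (0ℚ ∷ f * g)

ℚ[x]-rawRing : RawRing 0ℓ 0ℓ
ℚ[x]-rawRing = record
  { Carrier = ℚ[x]
  ; _≈_     = _≈_
  ; _+_     = _+_
  ; _*_     = _*_
  ; -_      = -_
  ; 0#      = []
  ; 1#      = 1ℚ ∷ []
  }

open RawRing ℚ[x]-rawRing public using (0#; 1#; _≉_)
open RawSemiringDefs (RawRing.rawSemiring ℚ[x]-rawRing) public
  using (_∣_; Coprime; product)

-- The degree of the zero polynomial is ⊥₋, below every natural number.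
deg : ℚ[x] → ℕ ₋
deg []      = ⊥₋
deg (a ∷ f) with deg f
... | [ d ] = [ suc d ]
... | ⊥₋ with a ℚ.≟ 0ℚ
...   | yes _ = ⊥₋
...   | no  _ = [ 0 ]

NonConstant : ℚ[x] → Set
NonConstant f = [ 0 ] <₋ deg f

_≡_[mod_] : ℚ[x] → ℚ[x] → ℚ[x] → Set
f ≡ g [mod a ] = a ∣ (f + (- g))

-- r = f rem p.  For p = 0 no r qualifies, since nothing lies below ⊥₋.
IsRem : (f p r : ℚ[x]) → Set
IsRem f p r = deg r <₋ deg p × ∃ λ q → f ≈ p * q + r

coeff-+ : ∀ f g n → coeff (f + g) n ≡ coeff f n ℚ.+ coeff g n
coeff-+ []      g       n       = sym (ℚ.+-identityˡ (coeff g n))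
coeff-+ (a ∷ f) []      n       = sym (ℚ.+-identityʳ (coeff (a ∷ f) n))
coeff-+ (a ∷ f) (b ∷ g) zero    = refl
coeff-+ (a ∷ f) (b ∷ g) (suc n) = coeff-+ f g n

coeff-· : ∀ a f n → coeff (a · f) n ≡ a ℚ.* coeff f n
coeff-· a []      n       = sym (ℚ.*-zeroʳ a)
coeff-· a (b ∷ f) zero    = refl
coeff-· a (b ∷ f) (suc n) = coeff-· a f n

coeff-* : ∀ a f g n →
          coeff ((a ∷ f) * g) n ≡ a ℚ.* coeff g n ℚ.+ coeff (0ℚ ∷ f * g) n
coeff-* a f g n = trans (coeff-+ (a · g) (0ℚ ∷ f * g) n)
                        (cong (ℚ._+ coeff (0ℚ ∷ f * g) n) (coeff-· a g n))

coeff-*-shift : ∀ f g n → coeff (f * (0ℚ ∷ g)) n ≡ coeff (0ℚ ∷ f * g) n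
coeff-*-shift []      g zero    = refl
coeff-*-shift []      g (suc n) = refl
coeff-*-shift (a ∷ f) g zero    =
  trans (coeff-* a f (0ℚ ∷ g) 0) (cong (ℚ._+ 0ℚ) (ℚ.*-zeroʳ a))
coeff-*-shift (a ∷ f) g (suc n) = begin
  coeff ((a ∷ f) * (0ℚ ∷ g)) (suc n)               ≡⟨ coeff-* a f (0ℚ ∷ g) (suc n) ⟩
  a ℚ.* coeff g n ℚ.+ coeff (f * (0ℚ ∷ g)) n       ≡⟨ cong (a ℚ.* coeff g n ℚ.+_) (coeff-*-shift f g n) ⟩
  a ℚ.* coeff g n ℚ.+ coeff (0ℚ ∷ f * g) n         ≡⟨ coeff-* a f g n ⟨
  coeff ((a ∷ f) * g) n                            ∎
  where open ≡-Reasoning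

ℚ-cancel : ∀ {a b} → ¬ a ≡ 0ℚ → a ℚ.* b ≡ 0ℚ → b ≡ 0ℚ
ℚ-cancel {a} {b} a≢0 ab≡0 = begin
  b                      ≡⟨ ℚ.*-identityˡ b ⟨
  1ℚ ℚ.* b               ≡⟨ cong (ℚ._* b) (ℚ.*-inverseˡ a) ⟨
  (1/ a) ℚ.* a ℚ.* b     ≡⟨ ℚ.*-assoc (1/ a) a b ⟩
  (1/ a) ℚ.* (a ℚ.* b)   ≡⟨ cong ((1/ a) ℚ.*_) ab≡0 ⟩
  (1/ a) ℚ.* 0ℚ          ≡⟨ ℚ.*-zeroʳ (1/ a) ⟩
  0ℚ                     ∎
  where
  open ≡-Reasoning
  instance _ = ℚ.≢-nonZero a≢0

∷-≈0 : ∀ {a f} → a ≡ 0ℚ → f ≈ 0# → (a ∷ f) ≈ 0#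
∷-≈0 a≡0 f≈0 = mk≈ λ { zero → a≡0 ; (suc n) → coeff-≡ f≈0 n }

*-cancel-unit : ∀ {a} f g → ¬ a ≡ 0ℚ → (a ∷ f) * g ≈ 0# → g ≈ 0#
*-cancel-unit         f []      a≢0 _   = mk≈ λ _ → refl
*-cancel-unit {a} f (b ∷ g) a≢0 fg≈0 = ∷-≈0 b≡0 (*-cancel-unit f g a≢0 rest)
  where
  b≡0 : b ≡ 0ℚ
  b≡0 = ℚ-cancel a≢0 (trans (sym (ℚ.+-identityʳ (a ℚ.* b)))
          (trans (sym (coeff-* a f (b ∷ g) 0)) (coeff-≡ fg≈0 0)))
  rest : (a ∷ f) * g ≈ 0#
  rest = mk≈ λ n → trans (sym (coeff-*-shift (a ∷ f) g (suc n)))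
           (subst (λ c → coeff ((a ∷ f) * (c ∷ g)) (suc n) ≡ 0ℚ) b≡0 (coeff-≡ fg≈0 (suc n)))

*-≉0 : ∀ f g → f ≉ 0# → g ≉ 0# → f * g ≉ 0#
*-≉0 []      g f≉0 g≉0 _    = f≉0 (mk≈ λ _ → refl)
*-≉0 (a ∷ f) g f≉0 g≉0 fg≈0 with a ℚ.≟ 0ℚ
... | no  a≢0  = g≉0 (*-cancel-unit f g a≢0 fg≈0)
... | yes refl = *-≉0 f g (λ f≈0 → f≉0 (∷-≈0 refl f≈0)) g≉0 (mk≈ λ n →
    trans (sym (ℚ.+-identityˡ (coeff (f * g) n)))
      (trans (cong (ℚ._+ coeff (f * g) n) (sym (ℚ.*-zeroˡ (coeff g (suc n)))))
        (trans (sym (coeff-* 0ℚ f g (suc n))) (coeff-≡ fg≈0 (suc n)))))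

1≉0 : 1# ≉ 0#
1≉0 1≈0 = ℚ.1≢0 (coeff-≡ 1≈0 0)

product-≉0 : ∀ {n} (p : Vector ℚ[x] n) → (∀ i → p i ≉ 0#) → product p ≉ 0#
product-≉0 {zero}  p p≉0 = 1≉0
product-≉0 {suc n} p p≉0 =
  *-≉0 (p zero) _ (p≉0 zero) (product-≉0 (λ i → p (suc i)) (λ i → p≉0 (suc i)))

deg-≈0 : ∀ f → f ≈ 0# → deg f ≡ ⊥₋
deg-≈0 []      _   = refl
deg-≈0 (a ∷ f) f≈0 rewrite deg-≈0 f (mk≈ λ n → coeff-≡ f≈0 (suc n)) with a ℚ.≟ 0ℚ
... | yes _   = refl
... | no  a≢0 = contradiction (coeff-≡ f≈0 0) a≢0

nonConstant⇒≉0 : ∀ f → NonConstant f → f ≉ 0#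
nonConstant⇒≉0 f 0<deg f≈0 with subst ([ 0 ] <₋_) (deg-≈0 f f≈0) 0<deg
... | ()

-- The field ℚ(x).  Fractions need not be in lowest terms; equality in ℚ(x)
-- is the cross-multiplication relation _≃_.

record ℚ⟨x⟩ : Set where
  constructor frac
  field
    num   : ℚ[x]
    den   : ℚ[x]
    den≉0 : den ≉ 0#

open ℚ⟨x⟩ public

infix 4 _≃_

record _≃_ (φ ψ : ℚ⟨x⟩) : Set where
  constructor mk≃
  field cross : num φ * den ψ ≈ num ψ * den φ

ℚ⟨x⟩-rawSemiring : RawSemiring 0ℓ 0ℓ
ℚ⟨x⟩-rawSemiring = record
  { Carrier = ℚ⟨x⟩
  ; _≈_     = _≃_
  ; _+_     = λ φ ψ → frac (num φ * den ψ + num ψ * den φ) (den φ * den ψ)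
                           (*-≉0 (den φ) (den ψ) (den≉0 φ) (den≉0 ψ))
  ; _*_     = λ φ ψ → frac (num φ * num ψ) (den φ * den ψ)
                           (*-≉0 (den φ) (den ψ) (den≉0 φ) (den≉0 ψ))
  ; 0#      = frac 0# 1# 1≉0
  ; 1#      = frac 1# 1# 1≉0
  }

open RawSemiringDefs ℚ⟨x⟩-rawSemiring public
  using () renaming (sum to sumᶠ; product to productᶠ)

-- k = eval(r/s; a), where φ = r/s.  The requirement gcd(s, a) = 1 is implied
-- by the existence of α.
IsEval : (φ : ℚ⟨x⟩) (a k : ℚ[x]) → Set
IsEval φ a k = ∃ λ α → (α * den φ ≡ 1# [mod a ]) × IsRem (α * num φ) a k

{-# OPTIONS --safe #-}
-- Clearing denominators, the claim is N = 1 for N = Σᵢ kᵢ ∏_{j≠i} pⱼ.  Modulo pᵢ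
-- only the i-th summand survives, and it is 1 by the choice of kᵢ, so each pᵢ
-- divides N − 1; the pᵢ being comaximal (Bézout), so does ∏ pᵢ.  Sums of proper
-- fractions are proper, so deg (N − 1) < deg ∏ pᵢ and therefore N = 1.
module Submission where

open import Algebra.Bundles using (AbelianGroup; CommutativeRing; CommutativeSemiring)
open import Algebra.Definitions.RawMagma using (_,_)
import Algebra.Construct.Pointwise as Pointwise
import Algebra.Morphism.GroupMonomorphism as GroupMonomorphism
import Algebra.Properties.AbelianGroup as AbelianGroupProperties
import Algebra.Properties.CommutativeMonoid.Sum as CommutativeMonoidSum
import Algebra.Properties.Semiring.Divisibility as Divisibility
open import Algebra.Structures using (IsAbelianGroup)
open import Data.Fin.Base using (zero; suc; punchIn)
open import Data.Fin.Properties using (punchInᵢ≢i)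
open import Data.List.Base using ([]; _∷_; length)
open import Data.Nat.Base as ℕ using (ℕ; zero; suc; z≤n; s≤s)
import Data.Nat.Properties as ℕ
open import Data.Product.Base using (_×_; _,_; ∃; ∃₂; proj₁; proj₂)
open import Data.Rational.Base as ℚ using (0ℚ; 1ℚ; 1/_)
import Data.Rational.Properties as ℚ
open import Data.Sum.Base using (inj₁; inj₂)
open import Data.Vec.Functional using (Vector; foldr; removeAt; tail)
open import Function.Base using (_∘_)
open import Level using (0ℓ)
open import Relation.Binary.Construct.Add.Infimum.Strict ℕ._<_ using (_<₋_; ⊥₋<[_]; [_])
open import Relation.Binary.PropositionalEquality
  using (_≡_; _≢_; refl; sym; trans; cong; cong₂; subst; module ≡-Reasoning)
import Relation.Binary.Reasoning.Setoid as SetoidReasoning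
open import Relation.Nullary using (yes; no; contradiction)
open import Relation.Nullary.Construct.Add.Infimum using ([_])

-- Comaximal elements of a commutative semiring.

module Comaximality {c ℓ} (R : CommutativeSemiring c ℓ) where

  open CommutativeSemiring R
    hiding (zero) renaming (refl to ≈-refl; sym to ≈-sym; trans to ≈-trans)
  open Divisibility semiring using (_∣_; 1∣_)
  open import Algebra.Definitions.RawSemiring rawSemiring using (product)
  open import Algebra.Solver.Ring.NaturalCoefficients.Default R
  open SetoidReasoning setoid

  -- The ideals generated by `a` and `b` sum to the whole semiring. Bézout coefficients express this
  -- without subtraction, so the semiring solver applies to the lemmas below.
  Comaximal : Carrier → Carrier → Set _
  Comaximal a b = ∃₂ λ u v → u * a + v * b ≈ 1#

  comaximal-1 : ∀ a → Comaximal a 1#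
  comaximal-1 a = 0# , 1# , ≈-trans (+-cong (zeroˡ a) (*-identityˡ 1#)) (+-identityˡ 1#)

  -- Multiply the two Bézout identities: in the expansion of the left side every term except
  -- `v * t * (b * c)` has a factor `a`.
  comaximal-* : ∀ {a b c} → Comaximal a b → Comaximal a c → Comaximal a (b * c)
  comaximal-* {a} {b} {c} (u , v , ua+vb≈1) (s , t , sa+tc≈1) =
    u * (s * a + t * c) + v * b * s , v * t , (begin
      (u * (s * a + t * c) + v * b * s) * a + v * t * (b * c)
        ≈⟨ solve 7 (λ u v s t a b c →
             (u :* (s :* a :+ t :* c) :+ v :* b :* s) :* a :+ v :* t :* (b :* c)
             := (u :* a :+ v :* b) :* (s :* a :+ t :* c)) ≈-refl u v s t a b c ⟩
      (u * a + v * b) * (s * a + t * c)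
        ≈⟨ *-cong ua+vb≈1 sa+tc≈1 ⟩
      1# * 1#
        ≈⟨ *-identityˡ 1# ⟩
      1# ∎)

  comaximal-product : ∀ {n a} (p : Vector Carrier n) →
                      (∀ i → Comaximal a (p i)) → Comaximal a (product p)
  comaximal-product {zero}  {a} p com = comaximal-1 a
  comaximal-product {suc n} {a} p com =
    comaximal-* (com zero) (comaximal-product (tail p) (com ∘ suc))

  -- In `c = u * a * c + v * b * c`, replace `c` by a multiple of `b` in the first term and by a
  -- multiple of `a` in the second; both terms become multiples of `a * b`.
  comaximal-∣-* : ∀ {a b c} → Comaximal a b → a ∣ c → b ∣ c → (a * b) ∣ c
  comaximal-∣-* {a} {b} {c} (u , v , ua+vb≈1) (k , ka≈c) (l , lb≈c) =
    u * l + v * k , (begin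
      (u * l + v * k) * (a * b)
        ≈⟨ solve 6 (λ u v k l a b →
             (u :* l :+ v :* k) :* (a :* b)
             := u :* a :* (l :* b) :+ v :* b :* (k :* a)) ≈-refl u v k l a b ⟩
      u * a * (l * b) + v * b * (k * a)
        ≈⟨ +-cong (*-congˡ lb≈c) (*-congˡ ka≈c) ⟩
      u * a * c + v * b * c
        ≈⟨ distribʳ c (u * a) (v * b) ⟨
      (u * a + v * b) * c
        ≈⟨ *-congʳ ua+vb≈1 ⟩
      1# * c
        ≈⟨ *-identityˡ c ⟩
      c ∎)

  -- Induction on the number of factors: the first is comaximal to the product of the others, so the
  -- two divisibilities combine.
  product-∣ : ∀ {n c} (p : Vector Carrier n) → (∀ i j → i ≢ j → Comaximal (p i) (p j)) →
              (∀ i → p i ∣ c) → product p ∣ c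
  product-∣ {zero}  {c} p com p∣c = 1∣ c
  product-∣ {suc n} {c} p com p∣c = comaximal-∣-*
    (comaximal-product (tail p) λ j → com zero (suc j) λ ())
    (p∣c zero)
    (product-∣ (tail p) (λ i j i≢j → com (suc i) (suc j) λ { refl → i≢j refl }) (p∣c ∘ suc))

open import Defs

-- The commutative ring of polynomials.

coeff-neg : ∀ f n → coeff (- f) n ≡ ℚ.- coeff f n
coeff-neg []      n       = refl
coeff-neg (a ∷ f) zero    = refl
coeff-neg (a ∷ f) (suc n) = coeff-neg f n

-- The group laws are pulled back along `coeff` from the functions from `ℕ` to `ℚ` under pointwise
-- addition; injectivity of `coeff` is the definition of `_≈_`.
+-isAbelianGroup : IsAbelianGroup _≈_ _+_ 0# -_
+-isAbelianGroup = GroupMonomorphism.isAbelianGroup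
  {G₂ = AbelianGroup.rawGroup (Pointwise.abelianGroup ℕ ℚ.+-0-abelianGroup)}
  record
    { isGroupHomomorphism = record
      { isMonoidHomomorphism = record
        { isMagmaHomomorphism = record
          { isRelHomomorphism = record { cong = coeff-≡ }
          ; homo = coeff-+
          }
        ; ε-homo = λ _ → refl
        }
      ; ⁻¹-homo = coeff-neg
      }
    ; injective = mk≈
    }
  (Pointwise.isAbelianGroup ℕ ℚ.+-0-isAbelianGroup)

+-abelianGroup : AbelianGroup 0ℓ 0ℓ
+-abelianGroup = record { isAbelianGroup = +-isAbelianGroup }

private
  module + = AbelianGroup +-abelianGroup

open import Algebra.Properties.CommutativeSemigroup +.commutativeSemigroup
  using (interchange; x∙yz≈y∙xz)

∷-cong : ∀ {a b f g} → a ≡ b → f ≈ g → (a ∷ f) ≈ (b ∷ g)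
∷-cong a≡b f≈g = mk≈ λ { zero → a≡b ; (suc n) → coeff-≡ f≈g n }

·-congˡ : ∀ a {f g} → f ≈ g → a · f ≈ a · g
·-congˡ a {f} {g} f≈g = mk≈ λ n → trans (coeff-· a f n)
  (trans (cong (a ℚ.*_) (coeff-≡ f≈g n)) (sym (coeff-· a g n)))

·-zeroˡ : ∀ f → 0ℚ · f ≈ 0#
·-zeroˡ f = mk≈ λ n → trans (coeff-· 0ℚ f n) (ℚ.*-zeroˡ (coeff f n))

·-identityˡ : ∀ f → 1ℚ · f ≈ f
·-identityˡ f = mk≈ λ n → trans (coeff-· 1ℚ f n) (ℚ.*-identityˡ (coeff f n))

·-assoc : ∀ a b f → (a ℚ.* b) · f ≈ a · (b · f)
·-assoc a b f = mk≈ λ n → begin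
  coeff ((a ℚ.* b) · f) n      ≡⟨ coeff-· (a ℚ.* b) f n ⟩
  a ℚ.* b ℚ.* coeff f n        ≡⟨ ℚ.*-assoc a b (coeff f n) ⟩
  a ℚ.* (b ℚ.* coeff f n)      ≡⟨ cong (a ℚ.*_) (coeff-· b f n) ⟨
  a ℚ.* coeff (b · f) n        ≡⟨ coeff-· a (b · f) n ⟨
  coeff (a · (b · f)) n        ∎
  where open ≡-Reasoning

·-distribˡ-+ : ∀ a f g → a · (f + g) ≈ a · f + a · g
·-distribˡ-+ a f g = mk≈ λ n → begin
  coeff (a · (f + g)) n                    ≡⟨ coeff-· a (f + g) n ⟩
  a ℚ.* coeff (f + g) n                    ≡⟨ cong (a ℚ.*_) (coeff-+ f g n) ⟩
  a ℚ.* (coeff f n ℚ.+ coeff g n)          ≡⟨ ℚ.*-distribˡ-+ a (coeff f n) (coeff g n) ⟩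
  a ℚ.* coeff f n ℚ.+ a ℚ.* coeff g n      ≡⟨ cong₂ ℚ._+_ (coeff-· a f n) (coeff-· a g n) ⟨
  coeff (a · f) n ℚ.+ coeff (a · g) n      ≡⟨ coeff-+ (a · f) (a · g) n ⟨
  coeff (a · f + a · g) n                  ∎
  where open ≡-Reasoning

·-distribʳ-+ : ∀ f a b → (a ℚ.+ b) · f ≈ a · f + b · f
·-distribʳ-+ f a b = mk≈ λ n → begin
  coeff ((a ℚ.+ b) · f) n                  ≡⟨ coeff-· (a ℚ.+ b) f n ⟩
  (a ℚ.+ b) ℚ.* coeff f n                  ≡⟨ ℚ.*-distribʳ-+ (coeff f n) a b ⟩
  a ℚ.* coeff f n ℚ.+ b ℚ.* coeff f n      ≡⟨ cong₂ ℚ._+_ (coeff-· a f n) (coeff-· b f n) ⟨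
  coeff (a · f) n ℚ.+ coeff (b · f) n      ≡⟨ coeff-+ (a · f) (b · f) n ⟨
  coeff (a · f + b · f) n                  ∎
  where open ≡-Reasoning

*-zeroʳ : ∀ f → f * 0# ≈ 0#
*-zeroʳ []      = +.refl
*-zeroʳ (a ∷ f) = ∷-≈0 refl (*-zeroʳ f)

-- The mirror image of the defining equation of `_*_`, expanding the second factor instead of the
-- first. Commutativity follows by comparing the two.
*-∷ : ∀ f b g → f * (b ∷ g) ≈ b · f + (0ℚ ∷ f * g)
*-∷ []      b g = +.sym (∷-≈0 refl +.refl)
*-∷ (a ∷ f) b g = ∷-cong (cong (ℚ._+ 0ℚ) (ℚ.*-comm a b)) (begin
  a · g + f * (b ∷ g)               ≈⟨ +.∙-congˡ (*-∷ f b g) ⟩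
  a · g + (b · f + (0ℚ ∷ f * g))    ≈⟨ x∙yz≈y∙xz (a · g) (b · f) (0ℚ ∷ f * g) ⟩
  b · f + (a · g + (0ℚ ∷ f * g))    ∎)
  where open SetoidReasoning +.setoid

*-comm : ∀ f g → f * g ≈ g * f
*-comm []      g = +.sym (*-zeroʳ g)
*-comm (a ∷ f) g = +.trans (+.∙-congˡ (∷-cong refl (*-comm f g))) (+.sym (*-∷ g a f))

*-congˡ : ∀ f {g h} → g ≈ h → f * g ≈ f * h
*-congˡ []      g≈h = +.refl
*-congˡ (a ∷ f) g≈h = +.∙-cong (·-congˡ a g≈h) (∷-cong refl (*-congˡ f g≈h))

*-congʳ : ∀ h {f g} → f ≈ g → f * h ≈ g * h
*-congʳ h {f} {g} f≈g = begin
  f * h    ≈⟨ *-comm f h ⟩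
  h * f    ≈⟨ *-congˡ h f≈g ⟩
  h * g    ≈⟨ *-comm h g ⟩
  g * h    ∎
  where open SetoidReasoning +.setoid

*-distribʳ-+ : ∀ h f g → (f + g) * h ≈ f * h + g * h
*-distribʳ-+ h []      g       = +.refl
*-distribʳ-+ h (a ∷ f) []      = +.sym (+.identityʳ ((a ∷ f) * h))
*-distribʳ-+ h (a ∷ f) (b ∷ g) = begin
  (a ℚ.+ b) · h + (0ℚ ∷ (f + g) * h)
    ≈⟨ +.∙-cong (·-distribʳ-+ h a b) (∷-cong refl (*-distribʳ-+ h f g)) ⟩
  (a · h + b · h) + ((0ℚ ∷ f * h) + (0ℚ ∷ g * h))
    ≈⟨ interchange (a · h) (b · h) (0ℚ ∷ f * h) (0ℚ ∷ g * h) ⟩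
  (a · h + (0ℚ ∷ f * h)) + (b · h + (0ℚ ∷ g * h)) ∎
  where open SetoidReasoning +.setoid

*-distribˡ-+ : ∀ h f g → h * (f + g) ≈ h * f + h * g
*-distribˡ-+ h f g = begin
  h * (f + g)      ≈⟨ *-comm h (f + g) ⟩
  (f + g) * h      ≈⟨ *-distribʳ-+ h f g ⟩
  f * h + g * h    ≈⟨ +.∙-cong (*-comm f h) (*-comm g h) ⟩
  h * f + h * g    ∎
  where open SetoidReasoning +.setoid

·-*-assoc : ∀ a f g → (a · f) * g ≈ a · (f * g)
·-*-assoc a []      g = +.refl
·-*-assoc a (b ∷ f) g = begin
  (a ℚ.* b) · g + (0ℚ ∷ (a · f) * g)
    ≈⟨ +.∙-cong (·-assoc a b g) (∷-cong (sym (ℚ.*-zeroʳ a)) (·-*-assoc a f g)) ⟩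
  a · (b · g) + a · (0ℚ ∷ f * g)
    ≈⟨ ·-distribˡ-+ a (b · g) (0ℚ ∷ f * g) ⟨
  a · (b · g + (0ℚ ∷ f * g)) ∎
  where open SetoidReasoning +.setoid

*-assoc : ∀ f g h → (f * g) * h ≈ f * (g * h)
*-assoc []      g h = +.refl
*-assoc (a ∷ f) g h = begin
  (a · g + (0ℚ ∷ f * g)) * h
    ≈⟨ *-distribʳ-+ h (a · g) (0ℚ ∷ f * g) ⟩
  -- Multiplying the shifted list `0ℚ ∷ f * g` by `h` unfolds to a term `0ℚ · h`, which vanishes,
  -- plus the shifted product.
  (a · g) * h + (0ℚ · h + (0ℚ ∷ (f * g) * h))
    ≈⟨ +.∙-cong (·-*-assoc a g h) (+.∙-cong (·-zeroˡ h) (∷-cong refl (*-assoc f g h))) ⟩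
  a · (g * h) + (0ℚ ∷ f * (g * h)) ∎
  where open SetoidReasoning +.setoid

*-identityˡ : ∀ f → 1# * f ≈ f
*-identityˡ f = +.trans (+.∙-cong (·-identityˡ f) (∷-≈0 refl +.refl)) (+.identityʳ f)

ℚ[x]-commutativeRing : CommutativeRing 0ℓ 0ℓ
ℚ[x]-commutativeRing = record
  { isCommutativeRing = record
    { isRing = record
      { +-isAbelianGroup = +-isAbelianGroup
      ; *-cong           = λ {f} {f′} {g} f≈f′ g≈g′ → +.trans (*-congʳ g f≈f′) (*-congˡ f′ g≈g′)
      ; *-assoc          = *-assoc
      ; *-identity       = *-identityˡ , λ f → +.trans (*-comm f 1#) (*-identityˡ f)
      ; distrib          = *-distribˡ-+ , *-distribʳ-+
      }
    ; *-comm = *-comm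
    }
  }

module R = CommutativeRing ℚ[x]-commutativeRing
module ℚ[x]-∣ = Divisibility R.semiring
open Comaximality R.commutativeSemiring
open AbelianGroupProperties +-abelianGroup using (xyx⁻¹≈y; x∙y⁻¹≈ε⇒x≈y)
open import Algebra.Solver.Ring.NaturalCoefficients.Default R.commutativeSemiring

-- Degree bounds and exact degrees.

record Below (f : ℚ[x]) (n : ℕ) : Set where
  constructor mkBelow
  field vanishes : ∀ m → n ℕ.≤ m → coeff f m ≡ 0ℚ

open Below

-- `Below` and `HasDegree` look at coefficients only, so trailing zeros do no harm. The zero
-- polynomial is `Below` every bound and has no degree.
record HasDegree (f : ℚ[x]) (d : ℕ) : Set where
  field
    leading≢0 : coeff f d ≢ 0ℚ
    below     : Below f (suc d)

open HasDegree

below-≤ : ∀ {f m n} → m ℕ.≤ n → Below f m → Below f n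
below-≤ m≤n f<m = mkBelow λ k n≤k → vanishes f<m k (ℕ.≤-trans m≤n n≤k)

below-≈ : ∀ {f g n} → f ≈ g → Below f n → Below g n
below-≈ f≈g f<n = mkBelow λ m n≤m → trans (sym (coeff-≡ f≈g m)) (vanishes f<n m n≤m)

below-tail : ∀ {a f n} → Below (a ∷ f) (suc n) → Below f n
below-tail f<n = mkBelow λ m n≤m → vanishes f<n (suc m) (s≤s n≤m)

≈0⇒below : ∀ {f} → f ≈ 0# → ∀ n → Below f n
≈0⇒below f≈0 n = mkBelow λ m _ → coeff-≡ f≈0 m

below-0⇒≈0 : ∀ {f} → Below f 0 → f ≈ 0#
below-0⇒≈0 f<0 = mk≈ λ n → vanishes f<0 n z≤n

below-∷ : ∀ {a f n} → Below f n → Below (a ∷ f) (suc n)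
below-∷ f<n = mkBelow λ { (suc m) (s≤s n≤m) → vanishes f<n m n≤m }

below-+ : ∀ {f g n} → Below f n → Below g n → Below (f + g) n
below-+ {f} {g} f<n g<n = mkBelow λ m n≤m →
  trans (coeff-+ f g m) (cong₂ ℚ._+_ (vanishes f<n m n≤m) (vanishes g<n m n≤m))

below-neg : ∀ {f n} → Below f n → Below (- f) n
below-neg {f} f<n = mkBelow λ m n≤m → trans (coeff-neg f m) (cong ℚ.-_ (vanishes f<n m n≤m))

below-1 : Below 1# 1
below-1 = below-∷ (≈0⇒below R.refl 0)

coeff-*-shifted : ∀ a f g n → coeff g n ≡ 0ℚ →
                  coeff ((a ∷ f) * g) n ≡ coeff (0ℚ ∷ f * g) n
coeff-*-shifted a f g n gₙ≡0 = begin
  coeff ((a ∷ f) * g) n                            ≡⟨ coeff-* a f g n ⟩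
  a ℚ.* coeff g n ℚ.+ coeff (0ℚ ∷ f * g) n         ≡⟨ cong (λ c → a ℚ.* c ℚ.+ coeff (0ℚ ∷ f * g) n) gₙ≡0 ⟩
  a ℚ.* 0ℚ ℚ.+ coeff (0ℚ ∷ f * g) n                ≡⟨ cong (ℚ._+ coeff (0ℚ ∷ f * g) n) (ℚ.*-zeroʳ a) ⟩
  0ℚ ℚ.+ coeff (0ℚ ∷ f * g) n                      ≡⟨ ℚ.+-identityˡ _ ⟩
  coeff (0ℚ ∷ f * g) n                             ∎
  where open ≡-Reasoning

-- Bounding `g` by degree at most `n` keeps the bound on the product free of predecessors. At
-- indices above `n` the summand `a · g` contributes nothing, so the claim passes to the tail of
-- `f`.
below-* : ∀ {f g m n} → Below f m → Below g (suc n) → Below (f * g) (m ℕ.+ n)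
below-* {f} {g} {zero} {n} f<0 g≤n =
  ≈0⇒below (R.trans (*-congʳ g (below-0⇒≈0 f<0)) (R.zeroˡ g)) n
below-* {[]} {g} {suc m} f<m g≤n = ≈0⇒below R.refl _
below-* {a ∷ f} {g} {suc m} {n} f<m g≤n = mkBelow λ { (suc k) (s≤s m+n≤k) → trans
  (coeff-*-shifted a f g (suc k) (vanishes g≤n (suc k) (s≤s (ℕ.m+n≤o⇒n≤o m m+n≤k))))
  (vanishes (below-* (below-tail f<m) g≤n) k m+n≤k) }

-- Any other pair of indices with sum `m ℕ.+ n` has one index beyond its bound, so only the two top
-- coefficients meet.
coeff-*-top : ∀ {f g m n} → Below f (suc m) → Below g (suc n) →
              coeff (f * g) (m ℕ.+ n) ≡ coeff f m ℚ.* coeff g n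
coeff-*-top {[]} {g} {n = n} _ _ = sym (ℚ.*-zeroˡ (coeff g n))
coeff-*-top {a ∷ f} {g} {zero} {n} f≤0 g≤n = begin
  coeff ((a ∷ f) * g) n                        ≡⟨ coeff-* a f g n ⟩
  a ℚ.* coeff g n ℚ.+ coeff (0ℚ ∷ f * g) n     ≡⟨ cong (a ℚ.* coeff g n ℚ.+_) (coeff-≡ xfg≈0 n) ⟩
  a ℚ.* coeff g n ℚ.+ 0ℚ                       ≡⟨ ℚ.+-identityʳ _ ⟩
  a ℚ.* coeff g n                              ∎
  where
  open ≡-Reasoning
  xfg≈0 : (0ℚ ∷ f * g) ≈ 0#
  xfg≈0 = ∷-≈0 refl (R.trans (*-congʳ g (below-0⇒≈0 (below-tail f≤0))) (R.zeroˡ g))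
coeff-*-top {a ∷ f} {g} {suc m} {n} f≤m g≤n = trans
  (coeff-*-shifted a f g (suc m ℕ.+ n) (vanishes g≤n _ (s≤s (ℕ.m≤n+m n m))))
  (coeff-*-top (below-tail f≤m) g≤n)

hasDegree-1 : HasDegree 1# 0
hasDegree-1 = record { leading≢0 = ℚ.1≢0 ; below = below-1 }

hasDegree-* : ∀ {f g m n} → HasDegree f m → HasDegree g n → HasDegree (f * g) (m ℕ.+ n)
hasDegree-* hf hg = record
  { leading≢0 = λ fgₘₙ≡0 → leading≢0 hg
      (ℚ-cancel (leading≢0 hf) (trans (sym (coeff-*-top (below hf) (below hg))) fgₘₙ≡0))
  ; below = below-* (below hf) (below hg)
  }

-- Links the computed `deg` of the theorem's statement to the coefficientwise notions used in the
-- proof.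
data DegreeView (f : ℚ[x]) : Set where
  is-zero    : f ≈ 0# → DegreeView f
  has-degree : ∀ d → deg f ≡ [ d ] → HasDegree f d → DegreeView f

degreeView : ∀ f → DegreeView f
degreeView []      = is-zero R.refl
degreeView (a ∷ f) with degreeView f
... | has-degree d deg-f≡d hf =
  has-degree (suc d) deg≡ record { leading≢0 = leading≢0 hf ; below = below-∷ (below hf) }
  where
  deg≡ : deg (a ∷ f) ≡ [ suc d ]
  deg≡ rewrite deg-f≡d = refl
... | is-zero f≈0 with a ℚ.≟ 0ℚ
...   | yes a≡0 = is-zero (∷-≈0 a≡0 f≈0)
...   | no  a≢0 = has-degree 0 deg≡ record { leading≢0 = a≢0 ; below = below-∷ (≈0⇒below f≈0 0) }
  where
  deg≡ : deg (a ∷ f) ≡ [ 0 ]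
  deg≡ rewrite deg-≈0 f f≈0 with a ℚ.≟ 0ℚ
  ... | yes a≡0 = contradiction a≡0 a≢0
  ... | no  _   = refl

hasDegree-below : ∀ {f d n} → HasDegree f d → Below f n → d ℕ.< n
hasDegree-below {d = d} hf f<n = ℕ.≰⇒> λ n≤d → leading≢0 hf (vanishes f<n d n≤d)

deg<⇒below : ∀ {f d} → deg f <₋ [ d ] → Below f d
deg<⇒below {f} deg<d with degreeView f
... | is-zero f≈0 = ≈0⇒below f≈0 _
... | has-degree e deg≡e hf with subst (_<₋ _) deg≡e deg<d
...   | [ e<d ] = below-≤ e<d (below hf)

below⇒deg< : ∀ {f d} → Below f d → deg f <₋ [ d ]
below⇒deg< {f} {d} f<d with degreeView f
... | is-zero f≈0 = subst (_<₋ [ d ]) (sym (deg-≈0 f f≈0)) ⊥₋<[ d ]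
... | has-degree e deg≡e hd = subst (_<₋ [ d ]) (sym deg≡e) [ hasDegree-below hd f<d ]

nonConstant-degree : ∀ f → NonConstant f → ∃ λ d → deg f ≡ [ suc d ] × HasDegree f (suc d)
nonConstant-degree f 0<deg with degreeView f
... | is-zero f≈0 = contradiction f≈0 (nonConstant⇒≉0 f 0<deg)
... | has-degree d deg≡d hd with subst ([ 0 ] <₋_) deg≡d 0<deg
...   | [ s≤s {n = e} z≤n ] = e , deg≡d , hd

-- A nonzero cofactor of degree `e` would give `g` the degree `e ℕ.+ d`, which is at least `d`.
∣∧below⇒≈0 : ∀ {f g d} → HasDegree f d → f ∣ g → Below g d → g ≈ 0#
∣∧below⇒≈0 {f} {g} {d} hd (q , qf≈g) g<d with degreeView q
... | is-zero q≈0 = R.trans (R.sym qf≈g) (R.trans (*-congʳ f q≈0) (R.zeroˡ f))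
... | has-degree e _ hq = contradiction (ℕ.m≤n+m d e)
  (ℕ.<⇒≱ (hasDegree-below (hasDegree-* hq hd) (below-≈ (R.sym qf≈g) g<d)))

-- Division with remainder and Bézout's identity.

division : ∀ {p d} → HasDegree p d → ∀ f → ∃₂ λ q r → f ≈ p * q + r × Below r d
division {p} _ [] = 0# , 0# , R.sym (R.trans (R.+-identityʳ (p * 0#)) (R.zeroʳ p)) , ≈0⇒below R.refl _
division {p} {d} hd (a ∷ f) with division hd f
-- From f = p q + r follows a + x f = p (x q) + (a + x r). Here a + x r has degree at most `d`, and
-- `c` is chosen so that subtracting `c · p` removes its coefficient at `d`.
... | q , r , f≈pq+r , r<d = c ∷ q , (a ∷ r) + (- (c · p)) , f≈ , mkBelow r<
  where
  instance _ = ℚ.≢-nonZero (leading≢0 hd)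
  c = coeff (a ∷ r) d ℚ.* (1/ coeff p d)

  f≈ : (a ∷ f) ≈ p * (c ∷ q) + ((a ∷ r) + (- (c · p)))
  f≈ = begin
    a ∷ f
      ≈⟨ ∷-cong (sym (ℚ.+-identityˡ a)) f≈pq+r ⟩
    (0ℚ ∷ p * q) + (a ∷ r)
      ≈⟨ R.+-identityˡ _ ⟨
    0# + ((0ℚ ∷ p * q) + (a ∷ r))
      ≈⟨ R.+-congʳ (R.-‿inverseʳ (c · p)) ⟨
    (c · p + (- (c · p))) + ((0ℚ ∷ p * q) + (a ∷ r))
      ≈⟨ solve 4 (λ w x y z → (w :+ x) :+ (y :+ z) := (w :+ y) :+ (z :+ x)) R.refl
           (c · p) (- (c · p)) (0ℚ ∷ p * q) (a ∷ r) ⟩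
    (c · p + (0ℚ ∷ p * q)) + ((a ∷ r) + (- (c · p)))
      ≈⟨ R.+-congʳ (*-∷ p c q) ⟨
    p * (c ∷ q) + ((a ∷ r) + (- (c · p))) ∎
    where open SetoidReasoning R.setoid

  coeff-c·p : ∀ m → coeff ((a ∷ r) + (- (c · p))) m ≡ coeff (a ∷ r) m ℚ.- c ℚ.* coeff p m
  coeff-c·p m = trans (coeff-+ (a ∷ r) (- (c · p)) m)
    (cong (coeff (a ∷ r) m ℚ.+_) (trans (coeff-neg (c · p) m) (cong ℚ.-_ (coeff-· c p m))))

  open ≡-Reasoning

  r< : ∀ m → d ℕ.≤ m → coeff ((a ∷ r) + (- (c · p))) m ≡ 0ℚ
  -- At `m = d` the choice of `c` makes the difference cancel; beyond `d` the coefficients of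
  -- `a ∷ r` and of `p` are both zero.
  r< m d≤m with ℕ.m≤n⇒m<n∨m≡n d≤m
  r< m d≤m | inj₂ refl = begin
    coeff ((a ∷ r) + (- (c · p))) d        ≡⟨ coeff-c·p d ⟩
    coeff (a ∷ r) d ℚ.- c ℚ.* coeff p d    ≡⟨ cong (λ x → coeff (a ∷ r) d ℚ.- x) c*p≡ ⟩
    coeff (a ∷ r) d ℚ.- coeff (a ∷ r) d    ≡⟨ ℚ.+-inverseʳ (coeff (a ∷ r) d) ⟩
    0ℚ                                     ∎
    where
    c*p≡ : c ℚ.* coeff p d ≡ coeff (a ∷ r) d
    c*p≡ = begin
      coeff (a ∷ r) d ℚ.* (1/ coeff p d) ℚ.* coeff p d     ≡⟨ ℚ.*-assoc (coeff (a ∷ r) d) (1/ coeff p d) (coeff p d) ⟩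
      coeff (a ∷ r) d ℚ.* ((1/ coeff p d) ℚ.* coeff p d)   ≡⟨ cong (coeff (a ∷ r) d ℚ.*_) (ℚ.*-inverseˡ (coeff p d)) ⟩
      coeff (a ∷ r) d ℚ.* 1ℚ                               ≡⟨ ℚ.*-identityʳ _ ⟩
      coeff (a ∷ r) d                                      ∎
  r< (suc m) _ | inj₁ d<m@(s≤s d≤m) = begin
    coeff ((a ∷ r) + (- (c · p))) (suc m)    ≡⟨ coeff-c·p (suc m) ⟩
    coeff r m ℚ.- c ℚ.* coeff p (suc m)      ≡⟨ cong₂ (λ x y → x ℚ.- c ℚ.* y)
                                                  (vanishes r<d m d≤m)
                                                  (vanishes (below hd) (suc m) d<m) ⟩
    0ℚ ℚ.- c ℚ.* 0ℚ                          ≡⟨ cong (λ x → 0ℚ ℚ.- x) (ℚ.*-zeroʳ c) ⟩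
    0ℚ                                       ∎

-- The Euclidean algorithm; the bound n on g is its termination measure.
bézout : ∀ n f g → Below g n → ∃₂ λ u v → u * f + v * g ∣ f × u * f + v * g ∣ g
bézout n f g g<n with degreeView g
... | is-zero g≈0 = 1# , 0# ,
  (1# , (begin
    1# * (1# * f + 0# * g)   ≈⟨ solve 2 (λ f g → con 1 :* (con 1 :* f :+ con 0 :* g) := f) R.refl f g ⟩
    f                        ∎)) ,
  (0# , R.trans (R.zeroˡ (1# * f + 0# * g)) (R.sym g≈0))
  where open SetoidReasoning R.setoid
bézout zero    f g g<n | has-degree d _ hd = contradiction (hasDegree-below hd g<n) λ ()
bézout (suc n) f g g<n | has-degree d _ hd
  with q , r , f≈gq+r , r<d ← division hd f
  with u , v , (k , kw≈g) , (l , lw≈r) ← bézout n g r (below-≤ (ℕ.≤-pred (hasDegree-below hd g<n)) r<d)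
  -- Back-substitution: inserting r = f - g q into `u * g + v * r` gives these coefficients for `f`
  -- and `g`.
  = v , u + (- v) * q ,
    ℚ[x]-∣.∣-respˡ (R.sym gcd≈) (k * q + l , (begin
      (k * q + l) * (u * g + v * r)
        ≈⟨ solve 4 (λ k q l w → (k :* q :+ l) :* w := (k :* w) :* q :+ l :* w) R.refl k q l (u * g + v * r) ⟩
      (k * (u * g + v * r)) * q + l * (u * g + v * r)
        ≈⟨ R.+-cong (*-congʳ q kw≈g) lw≈r ⟩
      g * q + r
        ≈⟨ f≈gq+r ⟨
      f ∎)) ,
    ℚ[x]-∣.∣-respˡ (R.sym gcd≈) (k , kw≈g)
  where
  open SetoidReasoning R.setoid
  gcd≈ : v * f + (u + (- v) * q) * g ≈ u * g + v * r
  -- The solver is for semirings, so − v enters it as an independent variable w.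
  gcd≈ = begin
    v * f + (u + (- v) * q) * g
      ≈⟨ R.+-congʳ (*-congˡ v f≈gq+r) ⟩
    v * (g * q + r) + (u + (- v) * q) * g
      ≈⟨ solve 6 (λ v w u g q r →
           v :* (g :* q :+ r) :+ (u :+ w :* q) :* g
           := (v :+ w) :* (g :* q) :+ (u :* g :+ v :* r)) R.refl v (- v) u g q r ⟩
    (v + (- v)) * (g * q) + (u * g + v * r)
      ≈⟨ R.+-congʳ (*-congʳ (g * q) (R.-‿inverseʳ v)) ⟩
    0# * (g * q) + (u * g + v * r)
      ≈⟨ R.+-congʳ (R.zeroˡ (g * q)) ⟩
    0# + (u * g + v * r)
      ≈⟨ R.+-identityˡ _ ⟩
    u * g + v * r ∎

below-length : ∀ f → Below f (length f)
below-length []      = ≈0⇒below R.refl 0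
below-length (a ∷ f) = below-∷ (below-length f)

-- The combination found by `bézout` is a common divisor, hence divides `1#`; scaling by the
-- cofactor `c` turns it into `1#`.
coprime⇒comaximal : ∀ {f g} → Coprime f g → Comaximal f g
coprime⇒comaximal {f} {g} coprime
  with u , v , w∣f , w∣g ← bézout (length g) f g (below-length g)
  with c , cw≈1 ← coprime w∣f w∣g
  = c * u , c * v , (begin
    c * u * f + c * v * g
      ≈⟨ solve 5 (λ c u f v g → c :* u :* f :+ c :* v :* g := c :* (u :* f :+ v :* g))
           R.refl c u f v g ⟩
    c * (u * f + v * g)
      ≈⟨ cw≈1 ⟩
    1# ∎)
  where open SetoidReasoning R.setoid

-- Congruences and evaluation of fractions modulo a polynomial.

mod⇒≈ : ∀ {a} f g → f ≡ g [mod a ] → ∃ λ q → f ≈ g + q * a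
mod⇒≈ {a} f g (q , qa≈f-g) = q , (begin
  f                 ≈⟨ xyx⁻¹≈y g f ⟨
  g + f + (- g)     ≈⟨ R.+-assoc g f (- g) ⟩
  g + (f + (- g))   ≈⟨ R.+-congˡ qa≈f-g ⟨
  g + q * a         ∎)
  where open SetoidReasoning R.setoid

-- Together with `mod⇒≈` this trades a congruence for an equation without subtraction, on which the
-- semiring solver can work.
≈⇒mod : ∀ {a f g} q → f ≈ g + q * a → f ≡ g [mod a ]
≈⇒mod {a} {f} {g} q f≈g+qa = q , (begin
  q * a                 ≈⟨ xyx⁻¹≈y g (q * a) ⟨
  g + q * a + (- g)     ≈⟨ R.+-congʳ f≈g+qa ⟨
  f + (- g)             ∎)
  where open SetoidReasoning R.setoid

mod-trans : ∀ {a} f g h → f ≡ g [mod a ] → g ≡ h [mod a ] → f ≡ h [mod a ]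
mod-trans {a} f g h f≡g g≡h with q , f≈ ← mod⇒≈ f g f≡g | t , g≈ ← mod⇒≈ g h g≡h =
  ≈⇒mod (t + q) (begin
    f                      ≈⟨ f≈ ⟩
    g + q * a              ≈⟨ R.+-congʳ g≈ ⟩
    h + t * a + q * a      ≈⟨ R.+-assoc h (t * a) (q * a) ⟩
    h + (t * a + q * a)    ≈⟨ R.+-congˡ (R.distribʳ a t q) ⟨
    h + (t + q) * a        ∎)
  where open SetoidReasoning R.setoid

mod-resp-≈ : ∀ {a f f′ g g′} → f ≈ f′ → g ≈ g′ → f ≡ g [mod a ] → f′ ≡ g′ [mod a ]
mod-resp-≈ f≈f′ g≈g′ = ℚ[x]-∣.∣-respʳ (R.+-cong f≈f′ (R.-‿cong g≈g′))

-- The Bézout coefficient `v` inverts `den φ` modulo `a`, and division of `v * num φ` by `a` yields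
-- the value.
eval-exists : ∀ φ {a} → NonConstant a → Comaximal a (den φ) → ∃ (IsEval φ a)
eval-exists φ {a} nonConst (u , v , ua+vs≈1)
  with d , deg≡d , hd ← nonConstant-degree a nonConst
  with q , r , vn≈aq+r , r<d ← division hd (v * num φ)
  = r , v , ≈⇒mod (- u) vs≈ , subst (deg r <₋_) (sym deg≡d) (below⇒deg< r<d) , q , vn≈aq+r
  where
  open SetoidReasoning R.setoid
  vs≈ : v * den φ ≈ 1# + (- u) * a
  vs≈ = begin
    v * den φ                            ≈⟨ R.+-identityʳ (v * den φ) ⟨
    v * den φ + 0# * a                   ≈⟨ R.+-congˡ (*-congʳ a (R.-‿inverseʳ u)) ⟨
    -- Zero is inserted as `u + (- u)`: the `u` part completes the Bézout identity, and the `- u`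
    -- part remains as the multiple of `a`.
    v * den φ + (u + (- u)) * a          ≈⟨ solve 4 (λ t u w a → t :+ (u :+ w) :* a := (u :* a :+ t) :+ w :* a)
                                              R.refl (v * den φ) u (- u) a ⟩
    (u * a + v * den φ) + (- u) * a      ≈⟨ R.+-congʳ ua+vs≈1 ⟩
    1# + (- u) * a                       ∎

-- With r/s for `φ`: k is congruent to α r, so k s is congruent to r (α s), hence to r. All that the
-- identity needs from an evaluation is this congruence and the degree bound.
eval-mod : ∀ φ {a k} → IsEval φ a k → k * den φ ≡ num φ [mod a ]
eval-mod φ {a} {k} (α , αs≡1 , _ , q , αr≈aq+k) with c , αs≈1+ca ← mod⇒≈ (α * den φ) 1# αs≡1 =
  ≈⇒mod (r * c + (- q) * s) (begin
    k * s
      ≈⟨ R.+-identityʳ (k * s) ⟨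
    k * s + 0# * (a * s)
      ≈⟨ R.+-congˡ (*-congʳ (a * s) (R.-‿inverseʳ q)) ⟨
    k * s + (q + (- q)) * (a * s)
      ≈⟨ solve 5 (λ k s q w a → k :* s :+ (q :+ w) :* (a :* s) := (a :* q :+ k) :* s :+ w :* s :* a)
           R.refl k s q (- q) a ⟩
    (a * q + k) * s + (- q) * s * a
      ≈⟨ R.+-congʳ (*-congʳ s αr≈aq+k) ⟨
    α * r * s + (- q) * s * a
      ≈⟨ solve 4 (λ α r s t → α :* r :* s :+ t := r :* (α :* s) :+ t) R.refl α r s ((- q) * s * a) ⟩
    r * (α * s) + (- q) * s * a
      ≈⟨ R.+-congʳ (*-congˡ r αs≈1+ca) ⟩
    r * (1# + c * a) + (- q) * s * a
      ≈⟨ solve 4 (λ r c a t → r :* (con 1 :+ c :* a) :+ t :* a := r :+ (r :* c :+ t) :* a)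
           R.refl r c a ((- q) * s) ⟩
    r + (r * c + (- q) * s) * a ∎)
  where
  open SetoidReasoning R.setoid
  r = num φ
  s = den φ

-- Numerators and denominators of finite sums and products of fractions.

den-productᶠ : ∀ {n} (φ : Vector ℚ⟨x⟩ n) → den (productᶠ φ) ≡ product (den ∘ φ)
den-productᶠ {zero}  φ = refl
den-productᶠ {suc n} φ = cong (den (φ zero) *_) (den-productᶠ (tail φ))

num-productᶠ-1 : ∀ {n} (φ : Vector ℚ⟨x⟩ n) → (∀ i → num (φ i) ≈ 1#) → num (productᶠ φ) ≈ 1#
num-productᶠ-1 {zero}  φ num≈1 = R.refl
num-productᶠ-1 {suc n} φ num≈1 =
  R.trans (R.*-cong (num≈1 zero) (num-productᶠ-1 (tail φ) (num≈1 ∘ suc))) (*-identityˡ 1#)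

-- Fractions are added without cancellation, so the denominators multiply up literally. Having `_≡_`
-- here, not just `_≈_`, permits `subst`.
den-sumᶠ : ∀ {n} (φ : Vector ℚ⟨x⟩ n) → den (sumᶠ φ) ≡ product (den ∘ φ)
den-sumᶠ {zero}  φ = refl
den-sumᶠ {suc n} φ = cong (den (φ zero) *_) (den-sumᶠ (tail φ))

record Proper (φ : ℚ⟨x⟩) (d : ℕ) : Set where
  field
    den-degree : HasDegree (den φ) d
    num-below  : Below (num φ) d

open Proper

-- In the numerator of a sum of two fractions each term is one numerator, strictly bounded, times
-- the other denominator, whose degree is known; `below-*` bounds both terms by the sum of the
-- degrees.
proper-sumᶠ : ∀ {n} (φ : Vector ℚ⟨x⟩ n) (d : Vector ℕ n) →
              (∀ i → Proper (φ i) (d i)) → Proper (sumᶠ φ) (foldr ℕ._+_ 0 d)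
proper-sumᶠ {zero}  φ d proper = record { den-degree = hasDegree-1 ; num-below = ≈0⇒below R.refl 0 }
proper-sumᶠ {suc n} φ d proper = record
  { den-degree = hasDegree-* (den-degree head) (den-degree rest)
  ; num-below  = below-+
      (below-* (num-below head) (HasDegree.below (den-degree rest)))
      (subst (Below _) (ℕ.+-comm _ (d zero))
        (below-* (num-below rest) (HasDegree.below (den-degree head))))
  }
  where
  head = proper zero
  rest = proper-sumᶠ (tail φ) (tail d) (proper ∘ suc)

-- After cross-multiplication every summand other than the `i`-th carries the factor `den (φ i)`.
num-sumᶠ-mod : ∀ {n} (φ : Vector ℚ⟨x⟩ (suc n)) i →
               num (sumᶠ φ) ≡ num (φ i) * product (removeAt (den ∘ φ) i) [mod den (φ i) ]
num-sumᶠ-mod φ zero = ≈⇒mod (num (sumᶠ (tail φ)))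
  (R.+-congʳ (R.reflexive (cong (num (φ zero) *_) (den-sumᶠ (tail φ)))))
num-sumᶠ-mod {suc n} φ (suc i) 
  with q , N≈ ← mod⇒≈ (num (sumᶠ (tail φ)))
         (num (φ (suc i)) * product (removeAt (den ∘ tail φ) i)) (num-sumᶠ-mod (tail φ) i) =
  -- The quotient collects two multiples of `pᵢ`: the head's numerator times the tail's denominator,
  -- which contains `pᵢ`, and the multiple left over from the tail, scaled by `p₀`.
  ≈⇒mod (a * D + q * p₀) (begin
    a * den (sumᶠ (tail φ)) + N * p₀
      ≈⟨ R.+-cong (*-congˡ a (R.trans (R.reflexive (den-sumᶠ (tail φ)))
                                (sum-remove {i = i} (den ∘ tail φ))))
                  (*-congʳ p₀ N≈) ⟩
    a * (pᵢ * D) + (k * D + q * pᵢ) * p₀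
      ≈⟨ solve 6 (λ a pᵢ D k q p₀ →
           a :* (pᵢ :* D) :+ (k :* D :+ q :* pᵢ) :* p₀
           := k :* (p₀ :* D) :+ (a :* D :+ q :* p₀) :* pᵢ) R.refl a pᵢ D k q p₀ ⟩
    k * (p₀ * D) + (a * D + q * p₀) * pᵢ ∎)
  where
  open SetoidReasoning R.setoid
  -- In the multiplicative monoid `sum-remove` extracts one factor from a product.
  open CommutativeMonoidSum R.*-commutativeMonoid using (sum-remove)
  a  = num (φ zero)
  p₀ = den (φ zero)
  pᵢ = den (φ (suc i))
  k  = num (φ (suc i))
  D  = product (removeAt (den ∘ tail φ) i)
  N  = num (sumᶠ (tail φ))

-- Existence of the evaluations and the partial fraction identity.

theorem3p13 : ∀ (n : ℕ) (p : Vector ℚ[x] (suc n))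
    → (nonConst : ∀ i → NonConstant (p i))
    → (∀ i j → i ≢ j → Coprime (p i) (p j))
    → let p≉0 = λ i → nonConstant⇒≉0 (p i) (nonConst i)
          1/p = λ i → frac 1# (p i) (p≉0 i)
          Isk = λ i k → IsEval (productᶠ (removeAt 1/p i)) (p i) k
      in (∀ i → ∃ λ k → Isk i k)
         × (∀ (k : Vector ℚ[x] (suc n)) → (∀ i → Isk i (k i))
            → frac 1# (product p) (product-≉0 p p≉0)
              ≃ sumᶠ (λ i → frac (k i) (p i) (p≉0 i)))
theorem3p13 n p nonConst coprime = exists , identity
  where
  p≉0 = λ i → nonConstant⇒≉0 (p i) (nonConst i)
  1/p = λ i → frac 1# (p i) (p≉0 i)
  Isk = λ i k → IsEval (productᶠ (removeAt 1/p i)) (p i) k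

  comaximal : ∀ i j → i ≢ j → Comaximal (p i) (p j)
  comaximal i j i≢j = coprime⇒comaximal (coprime i j i≢j)

  exists : ∀ i → ∃ λ k → Isk i k
  exists i = eval-exists (productᶠ (removeAt 1/p i)) (nonConst i)
    (subst (Comaximal (p i)) (sym (den-productᶠ (removeAt 1/p i)))
      -- The factors of `removeAt p i` are `p (punchIn i j)`, and `punchIn i` skips `i`.
      (comaximal-product (removeAt p i) λ j → comaximal i (punchIn i j) (punchInᵢ≢i i j ∘ sym)))

  identity : ∀ (k : Vector ℚ[x] (suc n)) → (∀ i → Isk i (k i)) →
             frac 1# (product p) (product-≉0 p p≉0) ≃ sumᶠ (λ i → frac (k i) (p i) (p≉0 i))
  identity k isk = mk≃ (begin
    -- Both fractions have the denominator `product p`, so the cross-multiplied equation reduces to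
    -- `N ≈ 1#`.
    1# * den (sumᶠ φ)   ≈⟨ R.*-cong (R.sym N≈1) (R.reflexive (den-sumᶠ φ)) ⟩
    N * product p       ∎)
    where
    open SetoidReasoning R.setoid
    φ = λ i → frac (k i) (p i) (p≉0 i)
    N = num (sumᶠ φ)
    degree = λ i → nonConstant-degree (p i) (nonConst i)
    -- The degree of `product p`.
    D = foldr ℕ._+_ 0 (λ i → suc (proj₁ (degree i)))

    proper : ∀ i → Proper (φ i) (suc (proj₁ (degree i)))
    proper i = let d , deg≡d , hd = degree i in record
      { den-degree = hd
      ; num-below  = deg<⇒below (subst (deg (k i) <₋_) deg≡d (proj₁ (proj₂ (proj₂ (isk i)))))
      }

    proper-N : Proper (sumᶠ φ) D
    proper-N = proper-sumᶠ φ (λ i → suc (proj₁ (degree i))) proper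

    -- This is `eval-mod` for the product of the reciprocals, whose numerator is `1#` and whose
    -- denominator is the product of the other `p j`.
    kD≡1 : ∀ i → k i * product (removeAt p i) ≡ 1# [mod p i ]
    kD≡1 i = mod-resp-≈
      (*-congˡ (k i) (R.reflexive (den-productᶠ (removeAt 1/p i))))
      (num-productᶠ-1 (removeAt 1/p i) λ _ → R.refl)
      (eval-mod (productᶠ (removeAt 1/p i)) (isk i))

    N≡1 : ∀ i → N ≡ 1# [mod p i ]
    N≡1 i = mod-trans N (k i * product (removeAt p i)) 1# (num-sumᶠ-mod φ i) (kD≡1 i)

    N≈1 : N ≈ 1#
    N≈1 = x∙y⁻¹≈ε⇒x≈y N 1# (∣∧below⇒≈0
      (subst (λ f → HasDegree f D) (den-sumᶠ φ) (den-degree proper-N))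
      (product-∣ p comaximal N≡1)
      -- The constant `1#` is also below `D`: `D` is at least 1, since `p zero` has positive degree.
      (below-+ (num-below proper-N) (below-neg (below-≤ (s≤s z≤n) below-1))))
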